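{- Let $k\geq 2$ and let $H$ be a connected $k$-graph of order $h$ with maximum degree $\Delta=\Delta(H)$ and maximum disjoint degree $\Delta_0=\Delta_{0}(H)$. Then there exists a constant $\alpha=\alpha(k,\Delta_0)$ (depending only on $k$ and $\Delta_0$) such that \[ \mathrm{d}_{\mathrm{crit}}(H)\leq 1-\frac{1}{\alpha\Delta}. \] Moreover, unless $H$ is $\Delta$-regular, there also exists a constant $\beta=\beta(k,h)$ (depending only on $k$ and $h$) such that \[ \mathrm{d}_{\mathrm{crit}}(H)\leq 1-\frac{1}{\beta(\Delta-1)}. \] Both constants satisfy $\alpha,\beta\leq k\left(\frac{k}{k-1}\right)^{k-1}<ke$.
   Context: A $k$-graph $H$ has a vertex set $V(H)$ and edge set $E(H)\subseteq\binom{V(H)}{k}$. The neighbourhood of $v\in V(H)$ is $\Gamma_H(v)=\{B\in\binom{V(H)}{k-1}: \{v\}\cup B\in E(H)\}$; the degree of $v$ is $|\Gamma_H(v)|$ and $\Delta(H)=\max_v|\Gamma_H(v)|$. The maximum disjoint degree is $\Delta_0(H)=\max_{v\in V(H)}\max\{j: \text{there exist pairwise disjoint } B_1,\dots,B_j\in\Gamma_H(v)\}$. $H$ is $\Delta$-regular if every vertex has degree $\Delta$. Given $H$ with $V(H)=\{v_1,\dots,v_h\}$, a complete blow-up $\hat H$ is obtained by replacing each $v_i$ by a non-empty class $A_i$ of $a_i$ vertices (classes disjoint) and taking as edges all $k$-sets containing exactly one vertex from each of $A_{b_1},\dots,A_{b_k}$ for every edge $v_{b_1}\cdots v_{b_k}\in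 E(H)$. A blow-up of $H$ is any subgraph $G\subseteq\hat H$. For $e\in E(H)$, $G[e]$ is the $k$-partite subgraph of $G$ induced by $\bigcup_{v_i\in e}A_i$, and $d_e(G)=|E(G[e])|/\prod_{v_i\in e}a_i$; set $d(G)=\min_{e\in E(H)}d_e(G)$. An $H$-transversal in $G$ is a subgraph of $G$ isomorphic to $H$ with exactly one vertex in each class $A_i$ (and, correspondingly, containing the edge of $G$ on the representatives of each edge of $H$); $G$ is $H$-free if it contains no $H$-transversal. The critical edge density is $\mathrm{d}_{\mathrm{crit}}(H)=\sup\{d(G): G \text{ is an } H\text{ -free blow-up of } H\}$. -}

module Defs where

open import Data.Bool.Base using (Bool; true; false; _∧_; _∨_; not; if_then_else_)
open import Data.Nat.Base as ℕ using (ℕ; zero; suc; _∸_; _⊔_)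
open import Data.Fin.Base using (Fin; zero; suc)
open import Data.Fin.Properties using () renaming (_≟_ to _≟ᶠ_)
open import Data.Nat.Properties using () renaming (_≟_ to _≟ⁿ_)
open import Data.Fin.Subset using (Subset; inside; outside; ∣_∣; _∪_; _∩_; ⁅_⁆) renaming (⊥ to ∅)
open import Data.Vec.Base using (Vec; []; _∷_; lookup; tabulate)
open import Data.List.Base using (List; []; _∷_; _++_; map; foldr; allFin)
open import Data.List.Relation.Unary.All using (All)
open import Data.List.Relation.Unary.AllPairs using (AllPairs)
open import Data.Product.Base using (Σ; ∃; _×_)
open import Data.Integer.Base using (+_)
open import Data.Rational.Base as ℚ using (ℚ; 0ℚ; 1ℚ)
open import Relation.Binary.PropositionalEquality using (_≡_)
open import Relation.Binary.Construct.Closure.ReflexiveTransitive using (Star)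
open import Relation.Nullary.Decidable using (⌊_⌋)

subsets : (n : ℕ) → List (Subset n)
subsets zero    = [] ∷ []
subsets (suc n) = map (outside ∷_) (subsets n) ++ map (inside ∷_) (subsets n)

count : {A : Set} → (A → Bool) → List A → ℕ
count p []       = 0
count p (x ∷ xs) = if p x then suc (count p xs) else count p xs

memᵇ : {n : ℕ} → Fin n → Subset n → Bool
memᵇ x s = lookup s x

allInᵇ : {n : ℕ} → Subset n → (Fin n → Bool) → Bool
allInᵇ {n} s p = foldr (λ j b → (not (memᵇ j s) ∨ p j) ∧ b) true (allFin n)

image : {n m : ℕ} → (Fin n → Fin m) → Subset n → Subset m
image {n} f s = tabulate (λ i → foldr (λ j b → (memᵇ j s ∧ ⌊ f j ≟ᶠ i ⌋) ∨ b) false (allFin n))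

prodℕ : List ℕ → ℕ
prodℕ = foldr ℕ._*_ 1

-- the fraction n / d in ℚ (d = 0 never occurs for the blow-ups below,
-- since all classes are non-empty; we then return 0 by convention)
frac : ℕ → ℕ → ℚ
frac n zero    = 0ℚ
frac n (suc d) = (+ n) ℚ./ suc d

record KGraph (k n : ℕ) : Set where
  field
    edge    : Subset n → Bool
    uniform : ∀ s → edge s ≡ true → ∣ s ∣ ≡ k
open KGraph public

InΓ : {k n : ℕ} → KGraph k n → Fin n → Subset n → Set
InΓ {k} H v B = (∣ B ∣ ≡ k ∸ 1) × (edge H (⁅ v ⁆ ∪ B) ≡ true)

inΓᵇ : {k n : ℕ} → KGraph k n → Fin n → Subset n → Bool
inΓᵇ {k} H v B = ⌊ ∣ B ∣ ≟ⁿ k ∸ 1 ⌋ ∧ edge H (⁅ v ⁆ ∪ B)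

degree : {k n : ℕ} → KGraph k n → Fin n → ℕ
degree {k} {n} H v = count (inΓᵇ H v) (subsets n)

maxDegree : {k n : ℕ} → KGraph k n → ℕ
maxDegree {k} {n} H = foldr (λ v m → degree H v ⊔ m) 0 (allFin n)

Regular : {k n : ℕ} → KGraph k n → ℕ → Set
Regular H Δ = ∀ v → degree H v ≡ Δ

DisjointFamily : {k n : ℕ} → KGraph k n → Fin n → ℕ → Set
DisjointFamily {k} {n} H v j =
  Σ (List (Subset n)) λ Bs →
    (Data.List.Base.length Bs ≡ j) × All (InΓ H v) Bs × AllPairs (λ B C → B ∩ C ≡ ∅) Bs

IsMaxDisjointDegree : {k n : ℕ} → KGraph k n → ℕ → Set
IsMaxDisjointDegree H Δ₀ =
  (∃ λ v → DisjointFamily H v Δ₀) × (∀ v j → DisjointFamily H v j → j ℕ.≤ Δ₀)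

Adjacent : {k n : ℕ} → KGraph k n → Fin n → Fin n → Set
Adjacent H u v = ∃ λ s → (edge H s ≡ true) × (memᵇ u s ≡ true) × (memᵇ v s ≡ true)

Connected : {k n : ℕ} → KGraph k n → Set
Connected H = ∀ u v → Star (Adjacent H) u v

-- Blow-ups of H.  Vertex set Fin N, class map cls (class A_i = cls⁻¹(i)),
-- all classes non-empty, and G ⊆ Ĥ: every edge of G meets each class at
-- most once and its classes form an edge of H.

record BlowUp {k h : ℕ} (H : KGraph k h) : Set where
  field
    N        : ℕ
    cls      : Fin N → Fin h
    nonEmpty : ∀ i → ∃ λ x → cls x ≡ i
    G        : KGraph k N
    inComplete : ∀ s → edge G s ≡ true →
                   (∀ x y → memᵇ x s ≡ true → memᵇ y s ≡ true → cls x ≡ cls y → x ≡ y)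
                   × (edge H (image cls s) ≡ true)
open BlowUp public

classSize : {k h : ℕ} {H : KGraph k h} → BlowUp H → Fin h → ℕ
classSize B i = count (λ x → ⌊ cls B x ≟ᶠ i ⌋) (allFin (N B))

edgesOn : {k h : ℕ} {H : KGraph k h} → BlowUp H → Subset h → ℕ
edgesOn B e = count (λ s → edge (G B) s ∧ allInᵇ s (λ x → memᵇ (cls B x) e)) (subsets (N B))

density : {k h : ℕ} {H : KGraph k h} → BlowUp H → Subset h → ℚ
density {h = h} B e =
  frac (edgesOn B e)
       (prodℕ (map (λ i → if memᵇ i e then classSize B i else 1) (allFin h)))

-- d(G) = min_{e ∈ E(H)} d_e(G)  (densities are ≤ 1, so starting the
-- minimum at 1 is harmless when E(H) ≠ ∅)
minDensity : {k h : ℕ} {H : KGraph k h} → BlowUp H → ℚ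
minDensity {h = h} {H} B =
  foldr (λ e q → if edge H e then density B e ℚ.⊓ q else q) 1ℚ (subsets h)

Transversal : {k h : ℕ} {H : KGraph k h} → BlowUp H → Set
Transversal {h = h} {H} B =
  Σ (Fin h → Fin (N B)) λ φ →
    (∀ i → cls B (φ i) ≡ i) × (∀ e → edge H e ≡ true → edge (G B) (image φ e) ≡ true)

HFree : {k h : ℕ} {H : KGraph k h} → BlowUp H → Set
HFree B = Transversal B → Data.Empty.⊥
  where import Data.Empty

_^ℚ_ : ℚ → ℕ → ℚ
q ^ℚ zero  = 1ℚ
q ^ℚ suc n = q ℚ.* (q ^ℚ n)

constBound : ℕ → ℚ
constBound k = frac k 1 ℚ.* (frac k (k ∸ 1) ^ℚ (k ∸ 1))

ℕtoℚ : ℕ → ℚ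
ℕtoℚ n = frac n 1

{-# OPTIONS --safe #-}

-- Choose a representative of every class uniformly and independently, so that each edge of H fails
-- to be an edge of G with probability p, and let Q(W) count the choices for which no edge inside the
-- vertex set W fails.  If w lies on at most D edges inside W, then Q(W) ≥ (1 − 1/k) Q(W − w), by
-- induction on |W|: given that no edge inside W − w fails, an edge f = {w} ∪ B fails with
-- probability at most p Q((W − w) ∖ B) / Q(W − w) ≤ p (k/(k−1))^(k−1), because f is independent of
-- the edges avoiding it and B is deleted one vertex at a time; for p ≤ 1/(αD) with
-- α = k (k/(k−1))^(k−1) this is at most 1/(kD), and a union bound over the D edges finishes the step.
-- Deleting all vertices gives Q(V) > 0, i.e. a transversal.  Taking D = Δ is always possible.  For
-- D = Δ − 1, the vertices of B satisfy the degree condition because f itself is no longer inside the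
-- vertex set, and an irregular connected H can be deleted starting from a vertex of degree < Δ and
-- then always choosing a vertex on an edge that has already been destroyed.

module Submission where

open import Defs
open import Data.Bool.Base using (Bool; true; false; _∧_; _∨_; not; if_then_else_)
open import Data.Empty using (⊥-elim)
open import Data.Fin.Base using (Fin; zero; suc)
open import Data.Fin.Properties using (¬∀⟶∃¬) renaming (_≟_ to _≟ᶠ_)
open import Data.Fin.Subset using (Subset; inside; outside; _∈_; _∉_; _⊆_; ∣_∣)
open import Data.Fin.Subset.Properties using (_∈?_; ⊆-antisym; p⊂q⇒∣p∣<∣q∣)
open import Data.List.Base using (List; []; _∷_; map; length; foldr; filter; allFin; tabulate)
import Data.List.Membership.Propositional as L
open import Data.List.Membership.Propositional.Properties using (∈-map⁺; ∈-map⁻; ∈-++⁺ˡ; ∈-++⁺ʳ; ∈-allFin; ∈-filter⁺; ∈-filter⁻)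
open import Data.List.Properties using (map-tabulate)
open import Data.List.Relation.Unary.All using (All; []; _∷_)
open import Data.List.Relation.Unary.AllPairs using ([]; _∷_)
open import Data.List.Relation.Unary.Any using (here; there)
open import Data.List.Relation.Unary.Unique.Propositional using (Unique)
import Data.List.Relation.Unary.Unique.Propositional.Properties as Unique
import Data.Nat.Base as ℕ
import Data.Nat.Base as N
open import Data.Nat.Base using (ℕ; zero; _∸_; suc; _^_; z≤n; s≤s; NonZero; >-nonZero)
import Data.Nat.Properties as ℕ
open import Data.Nat.Tactic.RingSolver using (solve-∀)
open import Data.Product.Base using (∃; _×_; _,_; proj₁; proj₂)
open import Data.Sum.Base using (inj₁; inj₂)
open import Data.Vec.Base using (Vec; []; _∷_; lookup; here; there)
open import Data.Vec.Properties using (lookup⇒[]=; []=⇒lookup; lookup∘tabulate)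
open import Function.Base using (_∘_; id)
open import Relation.Binary.Construct.Closure.ReflexiveTransitive using (Star; ε; _◅_)
open import Relation.Binary.PropositionalEquality
open import Relation.Nullary using (¬_; Dec; yes; no)
open import Relation.Nullary.Decidable using (⌊_⌋; _×-dec_; isYes≗does; dec-true; dec-false; decidable-stable)

private variable
  X Y : Set
  n : ℕ

module Counting where

  open import Algebra.Properties.CommutativeSemigroup using (interchange)
  import Data.Bool.Properties as Bool
  open import Data.Fin.Subset using (_∪_; _─_; _-_; ⁅_⁆; ⊤; Nonempty)
  open import Data.Fin.Subset.Properties
  open import Data.Nat.Base using (_+_; _*_; _≤_; _<_)
  open import Data.Nat.Properties

  -- Indicators, finite sums and counting over lists.

  bit : Bool → ℕ
  bit true  = 1
  bit false = 0

  bit≤1 : ∀ b → bit b ≤ 1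
  bit≤1 true  = ≤-refl
  bit≤1 false = z≤n

  ∑ : List X → (X → ℕ) → ℕ
  ∑ []       F = 0
  ∑ (x ∷ xs) F = F x + ∑ xs F

  ∑-cong : ∀ (xs : List X) {F G : X → ℕ} → (∀ x → F x ≡ G x) → ∑ xs F ≡ ∑ xs G
  ∑-cong []       F≗G = refl
  ∑-cong (x ∷ xs) F≗G = cong₂ _+_ (F≗G x) (∑-cong xs F≗G)

  ∑-mono : ∀ (xs : List X) {F G : X → ℕ} → (∀ x → F x ≤ G x) → ∑ xs F ≤ ∑ xs G
  ∑-mono []       F≤G = z≤n
  ∑-mono (x ∷ xs) F≤G = +-mono-≤ (F≤G x) (∑-mono xs F≤G)

  ∑-+ : ∀ (xs : List X) (F G : X → ℕ) → ∑ xs (λ x → F x + G x) ≡ ∑ xs F + ∑ xs G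
  ∑-+ []       F G = refl
  ∑-+ (x ∷ xs) F G rewrite ∑-+ xs F G =
    interchange +-commutativeSemigroup (F x) (G x) (∑ xs F) (∑ xs G)

  ∑-*ˡ : ∀ (xs : List X) c (F : X → ℕ) → ∑ xs (λ x → c * F x) ≡ c * ∑ xs F
  ∑-*ˡ []       c F = sym (*-zeroʳ c)
  ∑-*ˡ (x ∷ xs) c F rewrite ∑-*ˡ xs c F = sym (*-distribˡ-+ c (F x) (∑ xs F))

  ∑-*ʳ : ∀ (xs : List X) c (F : X → ℕ) → ∑ xs (λ x → F x * c) ≡ ∑ xs F * c
  ∑-*ʳ xs c F = trans (∑-cong xs (λ x → *-comm (F x) c)) (trans (∑-*ˡ xs c F) (*-comm c _))

  ∑-zero : ∀ (xs : List X) → ∑ xs (λ _ → 0) ≡ 0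
  ∑-zero []       = refl
  ∑-zero (x ∷ xs) = ∑-zero xs

  ∑-comm : ∀ (xs : List X) (ys : List Y) (K : X → Y → ℕ) →
           ∑ xs (λ x → ∑ ys (K x)) ≡ ∑ ys (λ y → ∑ xs (λ x → K x y))
  ∑-comm []       ys K = sym (∑-zero ys)
  ∑-comm (x ∷ xs) ys K rewrite ∑-comm xs ys K = sym (∑-+ ys (K x) _)

  ∑-one : ∀ (xs : List X) → ∑ xs (λ _ → 1) ≡ length xs
  ∑-one []       = refl
  ∑-one (x ∷ xs) = cong suc (∑-one xs)

  ∑-member : ∀ {xs : List X} (F : X → ℕ) {x} → x L.∈ xs → F x ≤ ∑ xs F
  ∑-member F (here refl) = m≤m+n _ _
  ∑-member F (there p)   = ≤-trans (∑-member F p) (m≤n+m _ _)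

  ∑-positive : ∀ (xs : List X) (F : X → ℕ) → 0 < ∑ xs F → ∃ λ x → x L.∈ xs × 0 < F x
  ∑-positive (x ∷ xs) F pos with F x in eq
  ... | suc _ = x , here refl , subst (0 <_) (sym eq) (s≤s z≤n)
  ... | zero  with y , y∈xs , Fy>0 ← ∑-positive xs F pos = y , there y∈xs , Fy>0

  -- After the first non-zero term every later one vanishes: its index would be `t` again, against
  -- `Unique xs`. This later expresses that one choice of representatives selects at most one edge
  -- on given classes.
  ∑-unique : ∀ {xs : List X} {F : X → ℕ} {b} {t : X} → Unique xs → (∀ x → F x ≤ bit b) →
             (∀ x → 0 < F x → x ≡ t) → ∑ xs F ≤ bit b
  ∑-unique [] F≤b supp = z≤n
  ∑-unique {xs = x ∷ xs} {F} {b} (x≢xs ∷ u) F≤b supp with F x in eq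
  ... | zero  = ∑-unique u F≤b supp
  ... | suc m = ≤-trans (≤-reflexive (trans (cong (suc m +_) (vanishes xs x≢xs)) (+-identityʳ _)))
                        (subst (_≤ bit b) eq (F≤b x))
    where
    vanishes : ∀ ys → All (λ y → ¬ x ≡ y) ys → ∑ ys F ≡ 0
    vanishes []       []          = refl
    vanishes (y ∷ ys) (x≢y ∷ all) with F y in eq′
    ... | zero  = vanishes ys all
    ... | suc _ = ⊥-elim (x≢y (trans (supp x (subst (0 <_) (sym eq) (s≤s z≤n)))
                                     (sym (supp y (subst (0 <_) (sym eq′) (s≤s z≤n))))))

  count≡∑ : ∀ (p : X → Bool) xs → count p xs ≡ ∑ xs (bit ∘ p)
  count≡∑ p []       = refl
  count≡∑ p (x ∷ xs) with p x
  ... | true  = cong suc (count≡∑ p xs)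
  ... | false = count≡∑ p xs

  count-mono : ∀ {p q : X → Bool} xs → (∀ x → p x ≡ true → q x ≡ true) → count p xs ≤ count q xs
  count-mono []       p⇒q = z≤n
  count-mono {p = p} {q} (x ∷ xs) p⇒q with p x | q x | p⇒q x
  ... | false | false | _ = count-mono xs p⇒q
  ... | false | true  | _ = m≤n⇒m≤1+n (count-mono xs p⇒q)
  ... | true  | true  | _ = s≤s (count-mono xs p⇒q)
  ... | true  | false | f with () ← f refl

  count-mono-< : ∀ {p q : X → Bool} {xs y} → (∀ x → p x ≡ true → q x ≡ true) →
                 y L.∈ xs → p y ≡ false → q y ≡ true → count p xs < count q xs
  count-mono-< {xs = x ∷ xs} p⇒q (here refl) py qy rewrite py | qy = s≤s (count-mono xs p⇒q)
  count-mono-< {p = p} {q} {xs = x ∷ xs} p⇒q (there y∈xs) py qy with p x | q x | p⇒q x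
  ... | false | false | _ = count-mono-< p⇒q y∈xs py qy
  ... | false | true  | _ = m≤n⇒m≤1+n (count-mono-< p⇒q y∈xs py qy)
  ... | true  | true  | _ = s≤s (count-mono-< p⇒q y∈xs py qy)
  ... | true  | false | f with () ← f refl

  ∈-subsets : ∀ (s : Subset n) → s L.∈ subsets n
  ∈-subsets []            = here refl
  ∈-subsets (outside ∷ s) = ∈-++⁺ˡ (∈-map⁺ (outside ∷_) (∈-subsets s))
  ∈-subsets (inside ∷ s)  = ∈-++⁺ʳ _ (∈-map⁺ (inside ∷_) (∈-subsets s))

  subsets-unique : ∀ n → Unique (subsets n)
  subsets-unique zero    = [] ∷ []
  subsets-unique (suc n) =
    Unique.++⁺ (Unique.map⁺ (λ { refl → refl }) (subsets-unique n))
               (Unique.map⁺ (λ { refl → refl }) (subsets-unique n))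
               λ { (p , q) → disjoint (∈-map⁻ _ p) (∈-map⁻ _ q) }
    where
    disjoint : ∀ {s} → (∃ λ t → t L.∈ subsets n × s ≡ outside ∷ t) →
               ¬ (∃ λ t → t L.∈ subsets n × s ≡ inside ∷ t)
    disjoint (_ , _ , refl) (_ , _ , ())

  -- Products, and sums over independent choices.

  ∏ : (Fin n → ℕ) → ℕ
  ∏ g = prodℕ (tabulate g)

  ∏-cong : ∀ {f g : Fin n → ℕ} → (∀ i → f i ≡ g i) → ∏ f ≡ ∏ g
  ∏-cong {zero}  f≗g = refl
  ∏-cong {suc n} f≗g = cong₂ _*_ (f≗g zero) (∏-cong (f≗g ∘ suc))

  ∏-mono : ∀ {f g : Fin n → ℕ} → (∀ i → f i ≤ g i) → ∏ f ≤ ∏ g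
  ∏-mono {zero}  f≤g = ≤-refl
  ∏-mono {suc n} f≤g = *-mono-≤ (f≤g zero) (∏-mono (f≤g ∘ suc))

  ∏-* : ∀ (f g : Fin n → ℕ) → ∏ (λ i → f i * g i) ≡ ∏ f * ∏ g
  ∏-* {zero}  f g = refl
  ∏-* {suc n} f g rewrite ∏-* (f ∘ suc) (g ∘ suc) =
    [m*n]*[o*p]≡[m*o]*[n*p] (f zero) (g zero) (∏ (f ∘ suc)) (∏ (g ∘ suc))

  ∏-one : ∏ {n} (λ _ → 1) ≡ 1
  ∏-one {zero}  = refl
  ∏-one {suc n} = trans (*-identityˡ _) (∏-one {n})

  ∏-positive : ∀ {f : Fin n → ℕ} → (∀ i → 1 ≤ f i) → 1 ≤ ∏ f
  ∏-positive {n} {f} 1≤f = subst (_≤ ∏ f) (∏-one {n}) (∏-mono 1≤f)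

  ∏-bit : ∀ {b : Fin n → Bool} → 0 < ∏ (bit ∘ b) → ∀ i → b i ≡ true
  ∏-bit {suc n} {b} pos i with b zero in eq
  ∏-bit {suc n} {b} pos zero    | true = eq
  ∏-bit {suc n} {b} pos (suc i) | true = ∏-bit {b = b ∘ suc} (subst (0 <_) (*-identityˡ _) pos) i

  -- An unnormalised expectation: coordinate `i` is drawn uniformly and independently from `A i`,
  -- and `total A (λ _ → 1)` is the size of the sample space. Probabilities are compared as natural
  -- numbers, by cross-multiplication.
  total : (Fin n → List X) → (Vec X n → ℕ) → ℕ
  total {zero}  A F = F []
  total {suc n} A F = ∑ (A zero) λ x → total (A ∘ suc) λ ω → F (x ∷ ω)

  total-cong : ∀ (A : Fin n → List X) {F G : Vec X n → ℕ} → (∀ ω → F ω ≡ G ω) → total A F ≡ total A G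
  total-cong {zero}  A F≗G = F≗G []
  total-cong {suc n} A F≗G = ∑-cong (A zero) λ x → total-cong (A ∘ suc) λ ω → F≗G (x ∷ ω)

  total-mono : ∀ (A : Fin n → List X) {F G : Vec X n → ℕ} → (∀ ω → F ω ≤ G ω) → total A F ≤ total A G
  total-mono {zero}  A F≤G = F≤G []
  total-mono {suc n} A F≤G = ∑-mono (A zero) λ x → total-mono (A ∘ suc) λ ω → F≤G (x ∷ ω)

  total-+ : ∀ (A : Fin n → List X) (F G : Vec X n → ℕ) →
            total A (λ ω → F ω + G ω) ≡ total A F + total A G
  total-+ {zero}  A F G = refl
  total-+ {suc n} A F G =
    trans (∑-cong (A zero) λ x → total-+ (A ∘ suc) (λ ω → F (x ∷ ω)) (λ ω → G (x ∷ ω))) (∑-+ (A zero) _ _)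

  total-*ˡ : ∀ (A : Fin n → List X) c (F : Vec X n → ℕ) → total A (λ ω → c * F ω) ≡ c * total A F
  total-*ˡ {zero}  A c F = refl
  total-*ˡ {suc n} A c F =
    trans (∑-cong (A zero) λ x → total-*ˡ (A ∘ suc) c (λ ω → F (x ∷ ω))) (∑-*ˡ (A zero) c _)

  total-*ʳ : ∀ (A : Fin n → List X) c (F : Vec X n → ℕ) → total A (λ ω → F ω * c) ≡ total A F * c
  total-*ʳ A c F = trans (total-cong A (λ ω → *-comm (F ω) c)) (trans (total-*ˡ A c F) (*-comm c _))

  total-∑ : ∀ (A : Fin n → List X) (ys : List Y) (F : Y → Vec X n → ℕ) →
            total A (λ ω → ∑ ys λ y → F y ω) ≡ ∑ ys λ y → total A (F y)
  total-∑ {zero}  A ys F = refl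
  total-∑ {suc n} A ys F =
    trans (∑-cong (A zero) λ x → total-∑ (A ∘ suc) ys (λ y ω → F y (x ∷ ω))) (∑-comm (A zero) ys _)

  total-∏ : ∀ (A : Fin n → List X) (g : Fin n → X → ℕ) →
            total A (λ ω → ∏ λ i → g i (lookup ω i)) ≡ ∏ λ i → ∑ (A i) (g i)
  total-∏ {zero}  A g = refl
  total-∏ {suc n} A g =
    trans (∑-cong (A zero) λ x → trans (total-*ˡ (A ∘ suc) (g zero x) _)
                                       (cong (g zero x *_) (total-∏ (A ∘ suc) (g ∘ suc))))
          (∑-*ʳ (A zero) _ (g zero))

  total-one : ∀ (A : Fin n → List X) → total A (λ _ → 1) ≡ ∏ (length ∘ A)
  total-one {n} A = trans (total-cong A λ _ → sym (∏-one {n}))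
                          (trans (total-∏ A (λ _ _ → 1)) (∏-cong λ i → ∑-one (A i)))

  total-positive : ∀ (A : Fin n → List X) (F : Vec X n → ℕ) → 0 < total A F →
                   ∃ λ ω → (∀ i → lookup ω i L.∈ A i) × 0 < F ω
  total-positive {zero}  A F pos = [] , (λ ()) , pos
  total-positive {suc n} A F pos
    with x , x∈A , pos′ ← ∑-positive (A zero) _ pos
    with ω , ω∈A , Fω>0 ← total-positive (A ∘ suc) _ pos′
    = x ∷ ω , (λ { zero → x∈A ; (suc i) → ω∈A i }) , Fω>0

  -- The pair `merge e ω ψ`, `merge e ψ ω` is the pair `ω`, `ψ` with the coordinates outside `e`
  -- swapped.
  merge : Subset n → Vec X n → Vec X n → Vec X n
  merge []            []      []      = []
  merge (inside ∷ e)  (x ∷ ω) (y ∷ ψ) = x ∷ merge e ω ψ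
  merge (outside ∷ e) (x ∷ ω) (y ∷ ψ) = y ∷ merge e ω ψ

  lookup-merge-∈ : ∀ {e : Subset n} {i} → i ∈ e → (ω ψ : Vec X n) → lookup (merge e ω ψ) i ≡ lookup ω i
  lookup-merge-∈ here                        (x ∷ ω) (y ∷ ψ) = refl
  lookup-merge-∈ {e = inside  ∷ e} (there p) (x ∷ ω) (y ∷ ψ) = lookup-merge-∈ p ω ψ
  lookup-merge-∈ {e = outside ∷ e} (there p) (x ∷ ω) (y ∷ ψ) = lookup-merge-∈ p ω ψ

  lookup-merge-∉ : ∀ {e : Subset n} {i} → i ∉ e → (ω ψ : Vec X n) → lookup (merge e ω ψ) i ≡ lookup ψ i
  lookup-merge-∉ {e = inside  ∷ e} {zero}  p (x ∷ ω) (y ∷ ψ) = ⊥-elim (p here)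
  lookup-merge-∉ {e = outside ∷ e} {zero}  p (x ∷ ω) (y ∷ ψ) = refl
  lookup-merge-∉ {e = inside  ∷ e} {suc i} p (x ∷ ω) (y ∷ ψ) = lookup-merge-∉ (p ∘ there) ω ψ
  lookup-merge-∉ {e = outside ∷ e} {suc i} p (x ∷ ω) (y ∷ ψ) = lookup-merge-∉ (p ∘ there) ω ψ

  -- This turns F ω * G ω into F ω * G ψ when F only depends on e and G only on its complement.
  total-exchange : ∀ (A : Fin n → List X) (e : Subset n) (K : Vec X n → Vec X n → ℕ) →
                   total A (λ ω → total A (K ω)) ≡
                   total A (λ ω → total A λ ψ → K (merge e ω ψ) (merge e ψ ω))
  total-exchange A []      K = refl
  total-exchange {suc n} {X} A (s ∷ e) K = begin
    total A (λ ω → total A (K ω))          ≡⟨ pull K ⟩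
    ∑∑ (λ x y → total² (slice K x y))      ≡⟨ ∑-cong A₀ (λ x → ∑-cong A₀ λ y → total-exchange A′ e (slice K x y)) ⟩
    ∑∑ (λ x y → total² (λ ω ψ → slice K x y (merge e ω ψ) (merge e ψ ω))) ≡⟨ swap s ⟩
    ∑∑ (λ x y → total² (slice K′ x y))     ≡⟨ pull K′ ⟨
    total A (λ ω → total A (K′ ω))         ∎
    where
    open ≡-Reasoning
    A₀ = A zero
    A′ = A ∘ suc
    K′ : Vec X (suc n) → Vec X (suc n) → ℕ
    K′ ω ψ = K (merge (s ∷ e) ω ψ) (merge (s ∷ e) ψ ω)
    ∑∑ : (X → X → ℕ) → ℕ
    ∑∑ F = ∑ A₀ λ x → ∑ A₀ (F x)
    total² : (Vec X n → Vec X n → ℕ) → ℕ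
    total² F = total A′ λ ω → total A′ (F ω)
    slice : (Vec X (suc n) → Vec X (suc n) → ℕ) → X → X → Vec X n → Vec X n → ℕ
    slice L x y ω ψ = L (x ∷ ω) (y ∷ ψ)
    pull : ∀ L → total A (λ ω → total A (L ω)) ≡ ∑∑ (λ x y → total² (slice L x y))
    pull L = ∑-cong A₀ λ x → total-∑ A′ A₀ λ y ω → total A′ (slice L x y ω)
    swap : ∀ s → ∑∑ (λ x y → total² (λ ω ψ → slice K x y (merge e ω ψ) (merge e ψ ω))) ≡
           ∑∑ (λ x y → total² (λ ω ψ → K (merge (s ∷ e) (x ∷ ω) (y ∷ ψ)) (merge (s ∷ e) (y ∷ ψ) (x ∷ ω))))
    swap inside  = refl
    swap outside = ∑-comm A₀ A₀ _

  AgreeOn : Subset n → Vec X n → Vec X n → Set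
  AgreeOn e ω ψ = ∀ i → i ∈ e → lookup ω i ≡ lookup ψ i

  AgreeOff : Subset n → Vec X n → Vec X n → Set
  AgreeOff e ω ψ = ∀ i → i ∉ e → lookup ω i ≡ lookup ψ i

  -- E[FG] = E[F] E[G] with denominators cleared. The right side is the sum of `F ω * G ψ` over all
  -- pairs; swapping the coordinates outside `e` leaves `F ω` alone and turns `G ψ` into `G ω`,
  -- after which `ψ` is free and contributes the size of the sample space.
  total-independent : ∀ (A : Fin n → List X) (e : Subset n) (F G : Vec X n → ℕ) →
    (∀ ω ψ → AgreeOn e ω ψ → F ω ≡ F ψ) → (∀ ω ψ → AgreeOff e ω ψ → G ω ≡ G ψ) →
    total A (λ ω → F ω * G ω) * total A (λ _ → 1) ≡ total A F * total A G
  total-independent A e F G F-on G-off = sym (begin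
    total A F * total A G                             ≡⟨ total-*ʳ A (total A G) F ⟨
    total A (λ ω → F ω * total A G)                   ≡⟨ total-cong A (λ ω → total-*ˡ A (F ω) G) ⟨
    total A (λ ω → total A λ ψ → F ω * G ψ)           ≡⟨ total-exchange A e (λ ω ψ → F ω * G ψ) ⟩
    total A (λ ω → total A λ ψ → F (merge e ω ψ) * G (merge e ψ ω))
      ≡⟨ total-cong A (λ ω → total-cong A λ ψ → trans
           (cong₂ _*_ (F-on _ _ λ i i∈e → lookup-merge-∈ i∈e ω ψ) (G-off _ _ λ i i∉e → lookup-merge-∉ i∉e ψ ω))
           (sym (*-identityʳ (F ω * G ω)))) ⟩
    total A (λ ω → total A λ ψ → F ω * G ω * 1)       ≡⟨ total-cong A (λ ω → total-*ˡ A (F ω * G ω) λ _ → 1) ⟩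
    total A (λ ω → F ω * G ω * total A λ _ → 1)       ≡⟨ total-*ʳ A _ _ ⟩
    total A (λ ω → F ω * G ω) * total A (λ _ → 1)     ∎)
    where open ≡-Reasoning

  -- Boolean tests, deletion of elements from subsets, and averaging.

  ∧-true : ∀ {a b} → a ∧ b ≡ true → a ≡ true × b ≡ true
  ∧-true {true} {true} _ = refl , refl

  ⌊⌋-true : {P : Set} (p? : Dec P) → ⌊ p? ⌋ ≡ true → P
  ⌊⌋-true (yes p) _ = p

  true-⌊⌋ : {P : Set} (p? : Dec P) → P → ⌊ p? ⌋ ≡ true
  true-⌊⌋ p? p = trans (isYes≗does p?) (dec-true p? p)

  false-⌊⌋ : {P : Set} (p? : Dec P) → ¬ P → ⌊ p? ⌋ ≡ false
  false-⌊⌋ p? ¬p = trans (isYes≗does p?) (dec-false p? ¬p)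

  x∈p─q⇒x∉q : ∀ (p q : Subset n) {x} → x ∈ p ─ q → x ∉ q
  x∈p─q⇒x∉q (_ ∷ p) (inside  ∷ q) (there x∈) (there x∈q) = x∈p─q⇒x∉q p q x∈ x∈q
  x∈p─q⇒x∉q (_ ∷ p) (outside ∷ q) (there x∈) (there x∈q) = x∈p─q⇒x∉q p q x∈ x∈q

  x∉p-x : ∀ (p : Subset n) x → x ∉ p - x
  x∉p-x p x x∈ = x∈p─q⇒x∉q p ⁅ x ⁆ x∈ (x∈⁅x⁆ x)

  ∣p-x∣ : ∀ {p : Subset n} {x} → x ∈ p → suc ∣ p - x ∣ ≡ ∣ p ∣
  ∣p-x∣ {p = inside ∷ p}            here        = cong (suc ∘ ∣_∣) (p─⊥≡p p)
  ∣p-x∣ {p = inside ∷ p}  {suc x} (there x∈p) = cong suc (∣p-x∣ x∈p)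
  ∣p-x∣ {p = outside ∷ p} {suc x} (there x∈p) = ∣p-x∣ x∈p

  ⁅x⁆∪p-x≡p : ∀ {p : Subset n} {x} → x ∈ p → ⁅ x ⁆ ∪ (p - x) ≡ p
  ⁅x⁆∪p-x≡p {p = p} {x} x∈p = ⊆-antisym to from
    where
    to : ⁅ x ⁆ ∪ (p - x) ⊆ p
    to y∈ with x∈p∪q⁻ ⁅ x ⁆ (p - x) y∈
    ... | inj₁ y∈x = subst (_∈ p) (sym (x∈⁅y⁆⇒x≡y x y∈x)) x∈p
    ... | inj₂ y∈p = p─q⊆p p ⁅ x ⁆ y∈p
    from : p ⊆ ⁅ x ⁆ ∪ (p - x)
    from {y} y∈p with y ≟ᶠ x
    ... | yes refl = p⊆p∪q (p - x) (x∈⁅x⁆ x)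
    ... | no  y≢x  = q⊆p∪q ⁅ x ⁆ (p - x) (x∈p∧x≢y⇒x∈p-y y∈p y≢x)

  -- The bound F ≤ q is only needed for D = 0, where the last hypothesis is void.
  ∑-average : ∀ (xs : List X) (c : X → Bool) (F : X → ℕ) k D q → count c xs ≤ D →
              (∀ x → F x ≤ q) → (∀ x → c x ≡ true → F x * (k * D) ≤ q) →
              k * ∑ xs (λ x → bit (c x) * F x) ≤ q
  ∑-average xs c F k D q few F≤q F≤q/kD = go D few F≤q/kD
    where
    S = ∑ xs (λ x → bit (c x) * F x)
    weighted : ∀ {G : _ → ℕ} → (∀ x → c x ≡ true → G x ≤ q) → ∑ xs (λ x → bit (c x) * G x) ≤ count c xs * q
    weighted {G} G≤q = begin
      ∑ xs (λ x → bit (c x) * G x) ≤⟨ ∑-mono xs bound ⟩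
      ∑ xs (λ x → bit (c x) * q)   ≡⟨ ∑-*ʳ xs q (bit ∘ c) ⟩
      ∑ xs (bit ∘ c) * q           ≡⟨ cong (_* q) (count≡∑ c xs) ⟨
      count c xs * q               ∎
      where
      open ≤-Reasoning
      bound : ∀ x → bit (c x) * G x ≤ bit (c x) * q
      bound x with c x in eq
      ... | true  = *-monoʳ-≤ 1 (G≤q x eq)
      ... | false = z≤n
    open ≤-Reasoning
    go : ∀ D → count c xs ≤ D → (∀ x → c x ≡ true → F x * (k * D) ≤ q) → k * S ≤ q
    go zero few _ = begin
      k * S                 ≤⟨ *-monoʳ-≤ k (weighted λ x _ → F≤q x) ⟩
      k * (count c xs * q)  ≤⟨ *-monoʳ-≤ k (*-monoˡ-≤ q few) ⟩
      k * 0                 ≡⟨ *-zeroʳ k ⟩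
      0                     ≤⟨ z≤n ⟩
      q                     ∎
    go D@(suc _) few hyp = *-cancelˡ-≤ D (begin
      D * (k * S)                                  ≡⟨ rearrange D k S ⟩
      S * (k * D)                                  ≡⟨ ∑-*ʳ xs (k * D) _ ⟨
      ∑ xs (λ x → bit (c x) * F x * (k * D))       ≡⟨ ∑-cong xs (λ x → *-assoc (bit (c x)) (F x) (k * D)) ⟩
      ∑ xs (λ x → bit (c x) * (F x * (k * D)))     ≤⟨ weighted hyp ⟩
      count c xs * q                               ≤⟨ *-monoˡ-≤ q few ⟩
      D * q                                        ∎)
      where
      rearrange : ∀ D k S → D * (k * S) ≡ S * (k * D)
      rearrange = solve-∀

  -- Degrees inside a vertex set.

  contains : ∀ {k} → KGraph k n → Subset n → Fin n → Subset n → Bool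
  contains H W w B = inΓᵇ H w B ∧ ⌊ (⁅ w ⁆ ∪ B) ⊆? W ⌋

  -- Comparing cardinalities shows that `w` is not in a counted `B`, so each edge `f` at `w` inside
  -- `W` is counted exactly once, as `f - w`. Sharing this indexing with `degree` makes the two
  -- counts comparable term by term.
  degreeIn : ∀ {k} → KGraph k n → Subset n → Fin n → ℕ
  degreeIn {n = n} H W w = count (contains H W w) (subsets n)

  contains⇒InΓ : ∀ {k} (H : KGraph k n) W w B → contains H W w B ≡ true → InΓ H w B
  contains⇒InΓ H W w B eq with ∣B∣ , e ← ∧-true (proj₁ (∧-true eq)) = ⌊⌋-true (_ ≟ _) ∣B∣ , e

  inΓ-remove : ∀ {k} (H : KGraph (suc k) n) {f w} → edge H f ≡ true → w ∈ f → inΓᵇ H w (f - w) ≡ true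
  inΓ-remove H {f} {w} ef w∈f
    rewrite ⁅x⁆∪p-x≡p w∈f | ef | true-⌊⌋ (∣ f - w ∣ ≟ _) (suc-injective (trans (∣p-x∣ w∈f) (uniform H f ef))) = refl

  contains-remove : ∀ {k} (H : KGraph (suc k) n) {f w} W → edge H f ≡ true → w ∈ f → f ⊆ W →
                    contains H W w (f - w) ≡ true
  contains-remove H {f} {w} W ef w∈f f⊆W rewrite inΓ-remove H ef w∈f | ⁅x⁆∪p-x≡p w∈f = true-⌊⌋ (f ⊆? W) f⊆W

  degreeIn≤degree : ∀ {k} (H : KGraph k n) W w → degreeIn H W w ≤ degree H w
  degreeIn≤degree {n} H W w =
    count-mono {p = contains H W w} {q = inΓᵇ H w} (subsets n) λ B → proj₁ ∘ ∧-true

  -- The index `f - w` is counted by `degree` but not by `degreeIn`.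
  degreeIn<degree : ∀ {k} (H : KGraph (suc k) n) {f w} W → edge H f ≡ true → w ∈ f → ¬ f ⊆ W →
                    degreeIn H W w < degree H w
  degreeIn<degree H {f} {w} W ef w∈f f⊈W =
    count-mono-< (λ B → proj₁ ∘ ∧-true) (∈-subsets (f - w)) missing (inΓ-remove H ef w∈f)
    where
    missing : contains H W w (f - w) ≡ false
    missing rewrite inΓ-remove H ef w∈f | ⁅x⁆∪p-x≡p w∈f = false-⌊⌋ (f ⊆? W) f⊈W

  -- An edge f at w that leaves W does not count towards the degree of w in W,
  -- so this holds for D = Δ ∸ 1.
  Local : ∀ {k} → KGraph k n → ℕ → Set
  Local {n} H D = ∀ {W : Subset n} {w f} → edge H f ≡ true → w ∈ f → ¬ f ⊆ W → degreeIn H W w ≤ D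

  -- Degeneracy in the usual sense, for the subgraphs induced on vertex sets. It supplies the order
  -- in which the vertices are deleted.
  Degenerate : ∀ {k} → KGraph k n → ℕ → Set
  Degenerate {n} H D = ∀ {W : Subset n} → Nonempty W → ∃ λ w → w ∈ W × degreeIn H W w ≤ D

  -- The local lemma by vertex deletion.

  module LocalLemma {m h : ℕ} (H : KGraph (suc (suc m)) h) (A : Fin h → List X)
    (holds : Subset h → Vec X h → Bool)
    (holds-local : ∀ e {ω ψ} → AgreeOn e ω ψ → holds e ω ≡ holds e ψ)
    (D : ℕ) (Ω>0 : 0 < total A (λ _ → 1))
    -- This is p ≤ 1/(αD) with denominators cleared, since α = k (k/(k-1))^(k-1) equals k^k /
    -- (k-1)^(k-1).
    (rare : ∀ e → edge H e ≡ true → total A (λ ω → bit (not (holds e ω))) * (suc (suc m) ^ suc (suc m) * D)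
                                    ≤ total A (λ _ → 1) * suc m ^ suc m)
    (local : Local H D) where

    k k-1 : ℕ
    k   = suc (suc m)
    k-1 = suc m

    Ω : ℕ
    Ω = total A (λ _ → 1)

    bad : Subset h → Vec X h → ℕ
    bad e ω = bit (not (holds e ω))

    Violated : Subset h → Vec X h → Subset h → Set
    Violated W ω f = edge H f ≡ true × f ⊆ W × holds f ω ≡ false

    violated? : ∀ W ω → Dec (∃ (Violated W ω))
    violated? W ω = anySubset? λ f → (edge H f Bool.≟ true) ×-dec (f ⊆? W) ×-dec (holds f ω Bool.≟ false)

    good : Subset h → Vec X h → ℕ
    good W ω = bit (not ⌊ violated? W ω ⌋)

    good-antitone : ∀ {W W′ ω ω′} → (∃ (Violated W′ ω′) → ∃ (Violated W ω)) → good W ω ≤ good W′ ω′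
    good-antitone {W} {W′} {ω} {ω′} imp with violated? W ω | violated? W′ ω′
    ... | yes _ | _     = z≤n
    ... | no ¬v | yes v = ⊥-elim (¬v (imp v))
    ... | no _  | no _  = ≤-refl

    good-⊆ : ∀ {W W′} → W′ ⊆ W → ∀ ω → good W ω ≤ good W′ ω
    good-⊆ {W} {W′} W′⊆W ω = good-antitone {W} {W′} {ω} {ω} λ (f , ef , f⊆W′ , ¬holds) → f , ef , W′⊆W ∘ f⊆W′ , ¬holds

    good-off : ∀ {W e} → (∀ {x} → x ∈ W → x ∉ e) → ∀ ω ψ → AgreeOff e ω ψ → good W ω ≡ good W ψ
    good-off {W} {e} disj ω ψ agree = ≤-antisym (half ω ψ agree) (half ψ ω λ i i∉e → sym (agree i i∉e))
      where
      half : ∀ ω ψ → AgreeOff e ω ψ → good W ω ≤ good W ψ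
      half ω ψ agree = good-antitone {W} {W} {ω} {ψ} λ (f , ef , f⊆W , ¬holds) →
        f , ef , f⊆W , trans (holds-local f λ i i∈f → agree i (disj (f⊆W i∈f))) ¬holds

    Q : Subset h → ℕ
    Q W = total A (good W)

    Q-antitone : ∀ {W W′} → W′ ⊆ W → Q W ≤ Q W′
    Q-antitone W′⊆W = total-mono A (good-⊆ W′⊆W)

    bad∧good : Subset h → Subset h → ℕ
    bad∧good f W = total A λ ω → bad f ω * good W ω

    -- A choice that is good for `W - w` but not for `W` violates some edge `f` inside `W`. This `f`
    -- contains `w`, so it is recorded in the sum at the index `f - w`.
    union-bound : ∀ W w → Q (W - w) ≤ Q W + ∑ (subsets h) λ B → bit (contains H W w B) * bad∧good (⁅ w ⁆ ∪ B) (W - w)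
    union-bound W w = begin
      Q (W - w)                                      ≤⟨ total-mono A pointwise ⟩
      total A (λ ω → good W ω + ∑ (subsets h) (λ B → term B ω))
        ≡⟨ total-+ A (good W) _ ⟩
      Q W + total A (λ ω → ∑ (subsets h) (λ B → term B ω))
        ≡⟨ cong (Q W +_) (total-∑ A (subsets h) term) ⟩
      Q W + ∑ (subsets h) (λ B → total A (term B))
        ≡⟨ cong (Q W +_) (∑-cong (subsets h) λ B → total-*ˡ A (bit (contains H W w B)) _) ⟩
      Q W + ∑ (subsets h) (λ B → bit (contains H W w B) * bad∧good (⁅ w ⁆ ∪ B) (W - w)) ∎
      where
      open ≤-Reasoning
      term : Subset h → Vec X h → ℕ
      term B ω = bit (contains H W w B) * (bad (⁅ w ⁆ ∪ B) ω * good (W - w) ω)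
      pointwise : ∀ ω → good (W - w) ω ≤ good W ω + ∑ (subsets h) (λ B → term B ω)
      pointwise ω with violated? W ω
      ... | no _ = ≤-trans (bit≤1 (not ⌊ violated? (W - w) ω ⌋)) (m≤m+n 1 _)
      ... | yes (f , ef , f⊆W , ¬holds) with w ∈? f
      -- Here `f` already lies in `W - w`, so the left-hand side is 0.
      ...   | no w∉f = ≤-trans (good-antitone {W - w} {W} {ω} {ω} λ _ → f , ef , f⊆W-w , ¬holds)
                       (≤-trans (≤-reflexive zero-good) z≤n)
        where
        f⊆W-w : f ⊆ W - w
        f⊆W-w x∈f = x∈p∧x≢y⇒x∈p-y (f⊆W x∈f) λ { refl → w∉f x∈f }
        zero-good : good W ω ≡ 0
        zero-good with violated? W ω
        ... | yes _ = refl
        ... | no ¬v = ⊥-elim (¬v (f , ef , f⊆W , ¬holds))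
      ...   | yes w∈f = ≤-trans (≤-reflexive (sym term≡)) (∑-member (λ B → term B ω) (∈-subsets (f - w)))
        where
        term≡ : term (f - w) ω ≡ good (W - w) ω
        term≡ rewrite contains-remove H W ef w∈f f⊆W | ⁅x⁆∪p-x≡p w∈f | ¬holds =
          trans (+-identityʳ _) (+-identityʳ _)

    -- The inequality Q(W) ≥ (1 - 1/k) Q(W - w) in integers. The bound `n` on the size of `W` makes
    -- it an induction hypothesis.
    Removal : ℕ → Set
    Removal n = ∀ W w → ∣ W ∣ ≤ n → degreeIn H W w ≤ D → k-1 * Q (W - w) ≤ k * Q W

    -- The vertices of `B` are deleted one at a time, each at the cost of a factor k/(k-1). Every
    -- one of them lies on `f`, and `f` is never inside the current vertex set, so `local` keeps
    -- providing the degree bound.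
    remove-all : ∀ {n} → Removal n → ∀ j B W {f} → edge H f ≡ true → B ⊆ f → ¬ f ⊆ W →
                 ∣ W ∣ ≤ n → ∣ B ∣ ≤ j → k-1 ^ j * Q (W ─ B) ≤ k ^ j * Q W
    remove-all rem j B W ef B⊆f f⊈W ∣W∣≤n ∣B∣≤j with nonempty? B
    -- `j` only bounds the size of `B` from above; once `B` is exhausted, the leftover factors
    -- satisfy `k-1 ^ j ≤ k ^ j`.
    ... | no empty = *-mono-≤ (^-monoˡ-≤ j (n≤1+n k-1))
                       (Q-antitone λ x∈W → x∈p∧x∉q⇒x∈p─q x∈W λ x∈B → empty (_ , x∈B))
    remove-all rem zero B W ef B⊆f f⊈W ∣W∣≤n ∣B∣≤0 | yes (x , x∈B)
      with () ← ≤-trans (x∈p⇒∣p-x∣<∣p∣ x∈B) ∣B∣≤0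
    remove-all rem (suc j) B W {f} ef B⊆f f⊈W ∣W∣≤n ∣B∣≤j | yes (x , x∈B) = begin
      k-1 * k-1 ^ j * Q (W ─ B)              ≤⟨ *-monoʳ-≤ (k-1 * k-1 ^ j) (Q-antitone shrink) ⟩
      k-1 * k-1 ^ j * Q ((W - x) ─ (B - x))  ≡⟨ *-assoc k-1 (k-1 ^ j) _ ⟩
      k-1 * (k-1 ^ j * Q ((W - x) ─ (B - x)))
        ≤⟨ *-monoʳ-≤ k-1 (remove-all rem j (B - x) (W - x) ef (B⊆f ∘ p─q⊆p B ⁅ x ⁆)
             (λ f⊆ → f⊈W (p─q⊆p W ⁅ x ⁆ ∘ f⊆)) (≤-trans (∣p─q∣≤∣p∣ W ⁅ x ⁆) ∣W∣≤n)
             (≤-pred (≤-trans (x∈p⇒∣p-x∣<∣p∣ x∈B) ∣B∣≤j))) ⟩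
      k-1 * (k ^ j * Q (W - x))              ≡⟨ rearrange k-1 (k ^ j) (Q (W - x)) ⟩
      k ^ j * (k-1 * Q (W - x))              ≤⟨ *-monoʳ-≤ (k ^ j) (rem W x ∣W∣≤n (local ef (B⊆f x∈B) f⊈W)) ⟩
      k ^ j * (k * Q W)                      ≡⟨ rearrange (k ^ j) k (Q W) ⟩
      k * (k ^ j * Q W)                      ≡⟨ *-assoc k (k ^ j) (Q W) ⟨
      k * k ^ j * Q W                        ∎
      where
      open ≤-Reasoning
      rearrange : ∀ a b c → a * (b * c) ≡ b * (a * c)
      rearrange = solve-∀
      shrink : (W - x) ─ (B - x) ⊆ W ─ B
      shrink {y} y∈ = x∈p∧x∉q⇒x∈p─q (p─q⊆p W ⁅ x ⁆ y∈W-x) λ y∈B →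
        x∈p─q⇒x∉q (W - x) (B - x) y∈ (x∈p∧x≢y⇒x∈p-y y∈B λ { refl → x∉p-x W x y∈W-x })
        where y∈W-x = p─q⊆p (W - x) (B - x) y∈

    -- Shrinking `W` to `W ─ B` makes it disjoint from the edge `f`, so that failure of `f` and
    -- goodness become independent. Returning from `W ─ B` to `W` costs (k/(k-1))^(k-1) by
    -- `remove-all`, and `rare` leaves exactly 1/(kD). Both sides are first multiplied by `Ω * c`,
    -- the denominators of independence and of `rare`.
    bad∧good-bound : ∀ {n} → Removal n → ∀ W w B → ∣ W ∣ ≤ n → InΓ H w B → w ∉ W →
                     bad∧good (⁅ w ⁆ ∪ B) W * (k * D) ≤ Q W
    bad∧good-bound rem W w B ∣W∣≤n (∣B∣ , ef) w∉W = *-cancelʳ-≤ _ _ (Ω * c) {{Ωc≢0}} (begin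
      P * (k * D) * (Ω * c)                 ≤⟨ *-monoˡ-≤ (Ω * c) (*-monoˡ-≤ (k * D) P≤P′) ⟩
      P′ * (k * D) * (Ω * c)                ≡⟨ rearrange₁ P′ (k * D) Ω c ⟩
      P′ * Ω * (k * D) * c                  ≡⟨ cong (λ z → z * (k * D) * c) independent ⟩
      b * Q W′ * (k * D) * c                ≡⟨ rearrange₂ b (Q W′) (k * D) c ⟩
      b * (k * D) * (c * Q W′)              ≤⟨ *-monoʳ-≤ (b * (k * D)) (remove-all rem k-1 B W ef (q⊆p∪q ⁅ w ⁆ B)
                                                  (λ f⊆W → w∉W (f⊆W w∈f)) ∣W∣≤n (≤-reflexive ∣B∣)) ⟩
      b * (k * D) * (k ^ k-1 * Q W)         ≡⟨ rearrange₃ b k D (k ^ k-1) (Q W) ⟩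
      b * (k ^ k * D) * Q W                 ≤⟨ *-monoˡ-≤ (Q W) (rare f ef) ⟩
      Ω * c * Q W                           ≡⟨ *-comm (Ω * c) (Q W) ⟩
      Q W * (Ω * c)                         ∎)
      where
      open ≤-Reasoning
      f = ⁅ w ⁆ ∪ B
      w∈f : w ∈ f
      w∈f = p⊆p∪q B (x∈⁅x⁆ w)
      W′ = W ─ B
      c = k-1 ^ k-1
      b = total A (bad f)
      P = bad∧good f W
      P′ = bad∧good f W′
      Ωc≢0 : NonZero (Ω * c)
      Ωc≢0 = >-nonZero (*-mono-≤ Ω>0 (m^n>0 k-1 k-1))
      P≤P′ : P ≤ P′
      P≤P′ = total-mono A λ ω → *-monoʳ-≤ (bad f ω) (good-⊆ (p─q⊆p W B) ω)
      disjoint : ∀ {x} → x ∈ W′ → x ∉ f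
      disjoint x∈W′ x∈f with x∈p∪q⁻ ⁅ w ⁆ B x∈f
      ... | inj₁ x∈w = w∉W (subst (_∈ W) (x∈⁅y⁆⇒x≡y w x∈w) (p─q⊆p W B x∈W′))
      ... | inj₂ x∈B = x∈p─q⇒x∉q W B x∈W′ x∈B
      independent : P′ * Ω ≡ b * Q W′
      independent = total-independent A f (bad f) (good W′)
        (λ ω ψ agree → cong (bit ∘ not) (holds-local f agree)) (good-off disjoint)
      rearrange₁ : ∀ p d o c → p * d * (o * c) ≡ p * o * d * c
      rearrange₁ = solve-∀
      rearrange₂ : ∀ b q d c → b * q * d * c ≡ b * d * (c * q)
      rearrange₂ = solve-∀
      rearrange₃ : ∀ b k d c q → b * (k * d) * (c * q) ≡ b * (k * c * d) * q
      rearrange₃ = solve-∀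

    removal : ∀ n → Removal n
    removal n W w ∣W∣≤n low with w ∈? W
    -- Nothing is deleted in this case.
    ... | no w∉W = *-mono-≤ (n≤1+n k-1) (Q-antitone λ x∈W → x∈p∧x≢y⇒x∈p-y x∈W λ { refl → w∉W x∈W })
    removal zero W w ∣W∣≤0 low | yes w∈W with () ← ≤-trans (x∈p⇒∣p-x∣<∣p∣ w∈W) ∣W∣≤0
    -- `k * q` unfolds to `q + k-1 * q`, so cancelling one `q` leaves the claim; the union bound
    -- loses `k * S`, which averaging over at most `D` edges keeps below `q`.
    removal (suc n) W w ∣W∣≤n low | yes w∈W = +-cancelˡ-≤ q _ _ (begin
      k * q             ≤⟨ *-monoʳ-≤ k (union-bound W w) ⟩
      k * (Q W + S)     ≡⟨ *-distribˡ-+ k (Q W) S ⟩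
      k * Q W + k * S   ≤⟨ +-monoʳ-≤ (k * Q W) kS≤q ⟩
      k * Q W + q       ≡⟨ +-comm (k * Q W) q ⟩
      q + k * Q W       ∎)
      where
      open ≤-Reasoning
      q = Q (W - w)
      S = ∑ (subsets h) λ B → bit (contains H W w B) * bad∧good (⁅ w ⁆ ∪ B) (W - w)
      kS≤q : k * S ≤ q
      kS≤q = ∑-average (subsets h) (contains H W w) _ k D q low
        (λ B → total-mono A λ ω → ≤-trans (*-monoˡ-≤ _ (bit≤1 (not (holds (⁅ w ⁆ ∪ B) ω)))) (≤-reflexive (*-identityˡ _)))
        (λ B cB → bad∧good-bound (removal n) (W - w) w B
          (≤-pred (≤-trans (x∈p⇒∣p-x∣<∣p∣ w∈W) ∣W∣≤n)) (contains⇒InΓ H W w B cB) (x∉p-x W w))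

    -- Each deletion of a vertex of low degree preserves positivity backwards, by `removal`; at the
    -- empty set every choice is good, so the count is `Ω`.
    Q-positive : Degenerate H D → ∀ n W → ∣ W ∣ ≤ n → 0 < Q W
    Q-positive degen n W ∣W∣≤n with nonempty? W
    ... | no empty = subst (0 <_) (total-cong A λ ω → sym (all-good ω)) Ω>0
      where
      all-good : ∀ ω → good W ω ≡ 1
      all-good ω with violated? W ω
      ... | no _ = refl
      ... | yes (f , ef , f⊆W , _) with nonempty? f
      ...   | yes (x , x∈f) = ⊥-elim (empty (x , f⊆W x∈f))
      -- The empty set is not an edge, because edges have k ≥ 2 elements.
      ...   | no f-empty with () ← trans (sym (uniform H f ef)) (trans (cong ∣_∣ (Empty-unique f-empty)) (∣⊥∣≡0 h))
    Q-positive degen zero W ∣W∣≤0 | yes (x , x∈W) with () ← ≤-trans (x∈p⇒∣p-x∣<∣p∣ x∈W) ∣W∣≤0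
    Q-positive degen (suc n) W ∣W∣≤n | yes nonempty with w , w∈W , low ← degen nonempty =
      *-cancelˡ-< k 0 (Q W) (subst (_< k * Q W) (sym (*-zeroʳ k)) (≤-trans
        (*-mono-≤ (s≤s {n = m} z≤n) (Q-positive degen n (W - w) (≤-pred (≤-trans (x∈p⇒∣p-x∣<∣p∣ w∈W) ∣W∣≤n))))
        (removal _ W w ≤-refl low)))

    good⇒holds : ∀ ω → 0 < good ⊤ ω → ∀ e → edge H e ≡ true → holds e ω ≡ true
    good⇒holds ω pos e ee with holds e ω in eq | violated? ⊤ ω
    ... | true  | _     = refl
    ... | false | no ¬v = ⊥-elim (¬v (e , ee , ⊆⊤ , eq))
    good⇒holds ω () e ee | false | yes _

    avoid-all : Degenerate H D → ∃ λ ω → (∀ i → lookup ω i L.∈ A i) × (∀ e → edge H e ≡ true → holds e ω ≡ true)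
    avoid-all degen with ω , ω∈A , pos ← total-positive A (good ⊤) (Q-positive degen h ⊤ (∣p∣≤n ⊤)) =
      ω , ω∈A , good⇒holds ω pos

open Counting

import Data.Integer.Base as ℤ
open import Data.Integer.Base using (+_)
import Data.Integer.Properties as ℤ
open import Data.Rational.Base using (ℚ; 0ℚ; 1ℚ; _<_; _≤_; _-_; _*_; _+_; _⊓_; fromℚᵘ; NonNegative; Positive)
open import Data.Rational.Properties hiding (_≟_)
open import Data.Rational.Solver using (module +-*-Solver)
import Data.Rational.Unnormalised.Base as ℚᵘ
open import Data.Rational.Unnormalised.Base using (mkℚᵘ; *≡*)
import Data.Rational.Unnormalised.Properties as ℚᵘ

-- Passing between rational and natural inequalities.

fromℚᵘ-homo-* : ∀ p q → fromℚᵘ (p ℚᵘ.* q) ≡ fromℚᵘ p * fromℚᵘ q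
fromℚᵘ-homo-* p q = toℚᵘ-injective (ℚᵘ.≃-trans (toℚᵘ-fromℚᵘ (p ℚᵘ.* q)) (ℚᵘ.≃-sym (ℚᵘ.≃-trans
  (toℚᵘ-homo-* (fromℚᵘ p) (fromℚᵘ q)) (ℚᵘ.*-cong (toℚᵘ-fromℚᵘ p) (toℚᵘ-fromℚᵘ q)))))

fromℚᵘ-homo-+ : ∀ p q → fromℚᵘ (p ℚᵘ.+ q) ≡ fromℚᵘ p + fromℚᵘ q
fromℚᵘ-homo-+ p q = toℚᵘ-injective (ℚᵘ.≃-trans (toℚᵘ-fromℚᵘ (p ℚᵘ.+ q)) (ℚᵘ.≃-sym (ℚᵘ.≃-trans
  (toℚᵘ-homo-+ (fromℚᵘ p) (fromℚᵘ q)) (ℚᵘ.+-cong (toℚᵘ-fromℚᵘ p) (toℚᵘ-fromℚᵘ q)))))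

ℕtoℚ-* : ∀ a b → ℕtoℚ (a ℕ.* b) ≡ ℕtoℚ a * ℕtoℚ b
ℕtoℚ-* a b = trans (fromℚᵘ-cong {mkℚᵘ (+ (a ℕ.* b)) 0} {mkℚᵘ (+ a) 0 ℚᵘ.* mkℚᵘ (+ b) 0} (*≡* (cong (ℤ._* + 1) (ℤ.pos-* a b))))
                   (fromℚᵘ-homo-* (mkℚᵘ (+ a) 0) (mkℚᵘ (+ b) 0))

ℕtoℚ-+ : ∀ a b → ℕtoℚ (a ℕ.+ b) ≡ ℕtoℚ a + ℕtoℚ b
ℕtoℚ-+ a b = trans (fromℚᵘ-cong {mkℚᵘ (+ (a ℕ.+ b)) 0} {mkℚᵘ (+ a) 0 ℚᵘ.+ mkℚᵘ (+ b) 0} (*≡* (cong (ℤ._* + 1)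
                     (trans (ℤ.pos-+ a b) (sym (cong₂ ℤ._+_ (ℤ.*-identityʳ (+ a)) (ℤ.*-identityʳ (+ b))))))))
                   (fromℚᵘ-homo-+ (mkℚᵘ (+ a) 0) (mkℚᵘ (+ b) 0))

ℕtoℚ-cancel-≤ : ∀ {a b} → ℕtoℚ a ≤ ℕtoℚ b → a ℕ.≤ b
ℕtoℚ-cancel-≤ {a} {b} le = ℤ.drop‿+≤+ (subst₂ ℤ._≤_ (ℤ.*-identityʳ (+ a)) (ℤ.*-identityʳ (+ b)) (ℚᵘ.drop-*≤*
  (ℚᵘ.≤-respˡ-≃ (toℚᵘ-fromℚᵘ (mkℚᵘ (+ a) 0)) (ℚᵘ.≤-respʳ-≃ (toℚᵘ-fromℚᵘ (mkℚᵘ (+ b) 0)) (toℚᵘ-mono-≤ le)))))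

frac-* : ∀ n d .{{_ : NonZero d}} → frac n d * ℕtoℚ d ≡ ℕtoℚ n
frac-* n d@(suc d-1) = trans (sym (fromℚᵘ-homo-* (mkℚᵘ (+ n) d-1) (mkℚᵘ (+ d) 0)))
  (fromℚᵘ-cong {mkℚᵘ (+ n) d-1 ℚᵘ.* mkℚᵘ (+ d) 0} {mkℚᵘ (+ n) 0} (*≡* (begin
    + n ℤ.* + d ℤ.* + 1         ≡⟨ ℤ.*-assoc (+ n) (+ d) (+ 1) ⟩
    + n ℤ.* (+ d ℤ.* + 1)       ≡⟨ cong (+ n ℤ.*_) (sym (ℤ.pos-* d 1)) ⟩
    + n ℤ.* + (d ℕ.* 1)         ∎)))
  where open ≡-Reasoning

frac^-* : ∀ n d .{{_ : NonZero d}} j → (frac n d ^ℚ j) * ℕtoℚ (d ^ j) ≡ ℕtoℚ (n ^ j)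
frac^-* n d zero    = *-identityˡ 1ℚ
frac^-* n d (suc j) = begin
  q * (q ^ℚ j) * ℕtoℚ (d ℕ.* d ^ j)            ≡⟨ cong (q * (q ^ℚ j) *_) (ℕtoℚ-* d (d ^ j)) ⟩
  q * (q ^ℚ j) * (ℕtoℚ d * ℕtoℚ (d ^ j))       ≡⟨ exchange q (q ^ℚ j) (ℕtoℚ d) (ℕtoℚ (d ^ j)) ⟩
  q * ℕtoℚ d * ((q ^ℚ j) * ℕtoℚ (d ^ j))       ≡⟨ cong₂ _*_ (frac-* n d) (frac^-* n d j) ⟩
  ℕtoℚ n * ℕtoℚ (n ^ j)                        ≡⟨ ℕtoℚ-* n (n ^ j) ⟨
  ℕtoℚ (n ℕ.* n ^ j)                           ∎
  where
  open ≡-Reasoning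
  q = frac n d
  exchange : ∀ a b c d → a * b * (c * d) ≡ a * c * (b * d)
  exchange = solve 4 (λ a b c d → a :* b :* (c :* d) := a :* c :* (b :* d)) refl
    where open +-*-Solver

-- The constant is k^k / (k-1)^(k-1); this form lets the rational hypothesis be restated in
-- integers.
constBound-* : ∀ m → constBound (suc (suc m)) * ℕtoℚ (suc m ^ suc m) ≡ ℕtoℚ (suc (suc m) ^ suc (suc m))
constBound-* m = begin
  ℕtoℚ k * (frac k k-1 ^ℚ k-1) * ℕtoℚ (k-1 ^ k-1)   ≡⟨ *-assoc (ℕtoℚ k) _ _ ⟩
  ℕtoℚ k * ((frac k k-1 ^ℚ k-1) * ℕtoℚ (k-1 ^ k-1)) ≡⟨ cong (ℕtoℚ k *_) (frac^-* k k-1 k-1) ⟩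
  ℕtoℚ k * ℕtoℚ (k ^ k-1)                           ≡⟨ ℕtoℚ-* k (k ^ k-1) ⟨
  ℕtoℚ (k ^ k)                                      ∎
  where
  open ≡-Reasoning
  k = suc (suc m)
  k-1 = suc m

^ℚ-positive : ∀ q .{{_ : Positive q}} j → Positive (q ^ℚ j)
^ℚ-positive q zero    = _
^ℚ-positive q (suc j) = pos*pos⇒pos q (q ^ℚ j) {{^ℚ-positive q j}}

constBound-positive : ∀ m → Positive (constBound (suc (suc m)))
constBound-positive m = pos*pos⇒pos (ℕtoℚ k) {{normalize-pos k 1}} (frac k (suc m) ^ℚ suc m)
  {{^ℚ-positive (frac k (suc m)) {{normalize-pos k (suc m)}} (suc m)}}
  where k = suc (suc m)

-- With density x = n/d ≥ μ, the failure probability satisfies (1 - x) α D ≤ (1 - μ) α D ≤ 1.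
-- Multiplying by `d * c` and moving the negative term across gives the subtraction-free conclusion.
clear-denominators : ∀ α .{{_ : NonNegative α}} {c κ} → α * ℕtoℚ c ≡ ℕtoℚ κ →
  ∀ D n d .{{_ : NonZero d}} {μ} → μ ≤ frac n d → (1ℚ - μ) * (α * ℕtoℚ D) ≤ 1ℚ →
  d ℕ.* (κ ℕ.* D) ℕ.≤ d ℕ.* c ℕ.+ n ℕ.* (κ ℕ.* D)
clear-denominators α {c} {κ} αc≡κ D n d {μ} μ≤x small = ℕtoℚ-cancel-≤ (begin
  ι (d ℕ.* (κ ℕ.* D))                             ≡⟨ trans (ℕtoℚ-* d _) (cong (ι d *_) ιK) ⟩
  ι d * (α * ι c * ι D)                           ≡⟨ identity x α (ι D) (ι d) (ι c) ⟨
  (1ℚ - x) * (α * ι D) * (ι d * ι c) + x * ι d * (α * ι c * ι D)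
    ≤⟨ +-monoˡ-≤ _ (*-monoʳ-≤-nonNeg (ι d * ι c) {{dc≥0}} small′) ⟩
  1ℚ * (ι d * ι c) + x * ι d * (α * ι c * ι D)
    ≡⟨ cong₂ _+_ (trans (*-identityˡ _) (sym (ℕtoℚ-* d c)))
                 (trans (cong₂ _*_ (frac-* n d) (sym ιK)) (sym (ℕtoℚ-* n _))) ⟩
  ι (d ℕ.* c) + ι (n ℕ.* (κ ℕ.* D))               ≡⟨ ℕtoℚ-+ (d ℕ.* c) _ ⟨
  ι (d ℕ.* c ℕ.+ n ℕ.* (κ ℕ.* D))                 ∎)
  where
  open ≤-Reasoning
  x = frac n d
  ι = ℕtoℚ
  ιK : ι (κ ℕ.* D) ≡ α * ι c * ι D
  ιK = trans (ℕtoℚ-* κ D) (cong (_* ι D) (sym αc≡κ))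
  dc≥0 : NonNegative (ι d * ι c)
  dc≥0 = subst NonNegative (ℕtoℚ-* d c) (normalize-nonNeg (d ℕ.* c) 1)
  αD≥0 : NonNegative (α * ι D)
  αD≥0 = nonNeg*nonNeg⇒nonNeg α (ι D) {{normalize-nonNeg D 1}}
  small′ : (1ℚ - x) * (α * ι D) ≤ 1ℚ
  small′ = ≤-trans (*-monoʳ-≤-nonNeg (α * ι D) {{αD≥0}} (+-monoʳ-≤ 1ℚ (neg-antimono-≤ μ≤x))) small
  identity : ∀ x a D d c → (1ℚ - x) * (a * D) * (d * c) + x * d * (a * c * D) ≡ d * (a * c * D)
  identity = solve 5 (λ x a D d c →
    (con 1ℚ :- x) :* (a :* D) :* (d :* c) :+ x :* d :* (a :* c :* D) := d :* (a :* c :* D)) refl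
    where open +-*-Solver

-- Boolean folds and images of subsets.

foldr-∨⁻ : ∀ (p : X → Bool) xs → foldr (λ x b → p x ∨ b) false xs ≡ true → ∃ λ x → p x ≡ true
foldr-∨⁻ p (x ∷ xs) eq with p x in px
... | true  = x , px
... | false = foldr-∨⁻ p xs eq

foldr-∨⁺ : ∀ (p : X → Bool) {xs x} → x L.∈ xs → p x ≡ true → foldr (λ x b → p x ∨ b) false xs ≡ true
foldr-∨⁺ p (here refl) px rewrite px = refl
foldr-∨⁺ p {y ∷ _} (there x∈xs) px with p y
... | true  = refl
... | false = foldr-∨⁺ p x∈xs px

foldr-∧⁻ : ∀ (p : X → Bool) {xs x} → foldr (λ x b → p x ∧ b) true xs ≡ true → x L.∈ xs → p x ≡ true
foldr-∧⁻ p eq (here refl)  = proj₁ (∧-true eq)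
foldr-∧⁻ p {y ∷ _} eq (there x∈xs) = foldr-∧⁻ p (proj₂ (∧-true {p y} eq)) x∈xs

∈-image⁻ : ∀ {m} (f : Fin n → Fin m) s {i} → i ∈ image f s → ∃ λ j → j ∈ s × f j ≡ i
∈-image⁻ f s {i} i∈
  with j , eq ← foldr-∨⁻ _ (allFin _) (trans (sym (lookup∘tabulate _ i)) ([]=⇒lookup i∈))
  with j∈s , fj≡i ← ∧-true {memᵇ j s} eq
  = j , lookup⇒[]= j s j∈s , ⌊⌋-true (f j ≟ᶠ i) fj≡i

∈-image⁺ : ∀ {m} (f : Fin n → Fin m) {s j} → j ∈ s → f j ∈ image f s
∈-image⁺ f {s} {j} j∈s = lookup⇒[]= (f j) (image f s) (trans (lookup∘tabulate _ (f j))
  (foldr-∨⁺ _ (∈-allFin j) (cong₂ _∧_ ([]=⇒lookup j∈s) (true-⌊⌋ (f j ≟ᶠ f j) refl))))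

image-cong : ∀ {m} {f g : Fin n → Fin m} s → (∀ i → i ∈ s → f i ≡ g i) → image f s ≡ image g s
image-cong {f = f} {g} s f≗g = ⊆-antisym (half f g f≗g) (half g f λ i i∈s → sym (f≗g i i∈s))
  where
  half : ∀ f g → (∀ i → i ∈ s → f i ≡ g i) → image f s ⊆ image g s
  half f g f≗g i∈ with j , j∈s , refl ← ∈-image⁻ f s i∈ = subst (_∈ image g s) (sym (f≗g j j∈s)) (∈-image⁺ g j∈s)

allIn⁻ : ∀ {s : Subset n} {p} → allInᵇ s p ≡ true → ∀ {j} → j ∈ s → p j ≡ true
allIn⁻ {s = s} {p} eq {j} j∈s with r ← foldr-∧⁻ _ eq (∈-allFin j) rewrite []=⇒lookup j∈s = r

count≡length-filter : {P : X → Set} (P? : ∀ x → Dec (P x)) (xs : List X) →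
                      count (λ x → ⌊ P? x ⌋) xs ≡ length (filter P? xs)
count≡length-filter P? []       = refl
count≡length-filter P? (x ∷ xs) with P? x
... | yes _ = cong suc (count≡length-filter P? xs)
... | no  _ = count≡length-filter P? xs

-- Densities of a blow-up and random representatives.

module _ {k h : ℕ} {H : KGraph k h} (B : BlowUp H) where

  class : Fin h → List (Fin (N B))
  class i = filter (λ x → cls B x ≟ᶠ i) (allFin (N B))

  size : Fin h → ℕ
  size = length ∘ class

  ∈-class : ∀ x → x L.∈ class (cls B x)
  ∈-class x = ∈-filter⁺ (λ y → cls B y ≟ᶠ cls B x) (∈-allFin x) refl

  class-nonempty : ∀ i → 1 ℕ.≤ size i
  class-nonempty i with x , refl ← nonEmpty B i = subst (1 ℕ.≤_) (∑-one (class i)) (∑-member (λ _ → 1) (∈-class x))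

  sections : ℕ
  sections = total class (λ _ → 1)

  sections-positive : 0 ℕ.< sections
  sections-positive = subst (0 ℕ.<_) (sym (total-one class)) (∏-positive class-nonempty)

  holds : Subset h → Vec (Fin (N B)) h → Bool
  holds e ω = edge (G B) (image (lookup ω) e)

  holds-local : ∀ e {ω ψ} → AgreeOn e ω ψ → holds e ω ≡ holds e ψ
  holds-local e agree = cong (edge (G B)) (image-cong e agree)

  -- Complementary factors of `size`: the product of `sizeIn e` is the denominator of the density on
  -- `e`, and that of `sizeOut e` counts the free choices outside `e`.
  sizeIn sizeOut : Subset h → Fin h → ℕ
  sizeIn  e i = if memᵇ i e then size i else 1
  sizeOut e i = if memᵇ i e then 1 else size i

  -- Written exactly as the denominator in `density`, so that `density B e` is
  -- `frac (edgesOn B e) (volume e)` by definition.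
  volume : Subset h → ℕ
  volume e = prodℕ (map (λ i → if memᵇ i e then classSize B i else 1) (allFin h))

  volume≡∏ : ∀ e → volume e ≡ ∏ (sizeIn e)
  volume≡∏ e = trans (cong prodℕ (map-tabulate {n = h} id (λ i → if memᵇ i e then classSize B i else 1)))
    (∏-cong λ i → cong (λ z → if memᵇ i e then z else 1) (count≡length-filter (λ x → cls B x ≟ᶠ i) (allFin (N B))))

  volume-positive : ∀ e → 0 ℕ.< volume e
  volume-positive e = subst (0 ℕ.<_) (sym (volume≡∏ e)) (∏-positive positive)
    where
    positive : ∀ i → 1 ℕ.≤ sizeIn e i
    positive i with memᵇ i e
    ... | true  = class-nonempty i
    ... | false = ℕ.≤-refl

  sections≡volume*rest : ∀ e → sections ≡ volume e ℕ.* ∏ (sizeOut e)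
  sections≡volume*rest e = begin
    sections                                ≡⟨ total-one class ⟩
    ∏ size                                  ≡⟨ ∏-cong split ⟩
    ∏ (λ i → sizeIn e i ℕ.* sizeOut e i)    ≡⟨ ∏-* (sizeIn e) (sizeOut e) ⟩
    ∏ (sizeIn e) ℕ.* ∏ (sizeOut e)          ≡⟨ cong (ℕ._* ∏ (sizeOut e)) (volume≡∏ e) ⟨
    volume e ℕ.* ∏ (sizeOut e)              ∎
    where
    open ≡-Reasoning
    split : ∀ i → size i ≡ sizeIn e i ℕ.* sizeOut e i
    split i with memᵇ i e
    ... | true  = sym (ℕ.*-identityʳ _)
    ... | false = sym (ℕ.*-identityˡ _)

  inᵇ : Subset h → Subset (N B) → Bool
  inᵇ e s = edge (G B) s ∧ allInᵇ s (λ x → memᵇ (cls B x) e)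

  -- A product over the coordinates, so that its total factorises; for an edge s of G[e] it is the
  -- indicator that ω restricted to e selects s.
  agreesᵇ : Subset h → Subset (N B) → Fin h → Fin (N B) → Bool
  agreesᵇ e s i x = if memᵇ i e then memᵇ x s ∧ ⌊ cls B x ≟ᶠ i ⌋ else true

  agrees : Subset h → Subset (N B) → Vec (Fin (N B)) h → ℕ
  agrees e s ω = ∏ λ i → bit (agreesᵇ e s i (lookup ω i))

  -- The classes met by `s` form an edge of `H` contained in `e`; as both have k elements, they
  -- coincide.
  image-cls : ∀ e s → edge H e ≡ true → inᵇ e s ≡ true → ∀ {i} → i ∈ e → ∃ λ x → x ∈ s × cls B x ≡ i
  image-cls e s ee ines {i} i∈e with es , alls ← ∧-true ines with i ∈? image (cls B) s
  ... | yes i∈ = ∈-image⁻ (cls B) s i∈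
  ... | no  i∉ = ⊥-elim (ℕ.<-irrefl (trans (uniform H _ (proj₂ (inComplete B s es))) (sym (uniform H e ee)))
                          (p⊂q⇒∣p∣<∣q∣ (image⊆e , i , i∈e , i∉)))
    where
    image⊆e : image (cls B) s ⊆ e
    image⊆e j∈ with x , x∈s , refl ← ∈-image⁻ (cls B) s j∈ = lookup⇒[]= _ e (allIn⁻ alls x∈s)

  -- The total factorises over the classes: a class in `e` contributes at least the vertex of `s` in
  -- it, and a class outside `e` contributes all its vertices.
  agrees-many : ∀ e s → edge H e ≡ true → inᵇ e s ≡ true → ∏ (sizeOut e) ℕ.≤ total class (agrees e s)
  agrees-many e s ee ines = subst (∏ (sizeOut e) ℕ.≤_) (sym (total-∏ class λ i x → bit (agreesᵇ e s i x)))
    (∏-mono at)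
    where
    at : ∀ i → sizeOut e i ℕ.≤ ∑ (class i) (λ x → bit (agreesᵇ e s i x))
    at i with memᵇ i e in eq
    ... | false = ℕ.≤-reflexive (sym (∑-one (class i)))
    ... | true with x , x∈s , refl ← image-cls e s ee ines (lookup⇒[]= i e eq) =
      subst (ℕ._≤ ∑ (class i) λ y → bit (memᵇ y s ∧ ⌊ cls B y ≟ᶠ cls B x ⌋))
            (cong bit (cong₂ _∧_ ([]=⇒lookup x∈s) (true-⌊⌋ (cls B x ≟ᶠ cls B x) refl)))
            (∑-member (λ y → bit (memᵇ y s ∧ ⌊ cls B y ≟ᶠ cls B x ⌋)) (∈-class x))

  -- A vertex `y` of `s` and the representative of its class both lie in `s`, and `s` meets each
  -- class at most once, so they are equal.
  agrees⇒image : ∀ e s ω → inᵇ e s ≡ true → 0 ℕ.< agrees e s ω → s ≡ image (lookup ω) e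
  agrees⇒image e s ω ines pos with es , alls ← ∧-true ines = ⊆-antisym to from
    where
    at : ∀ {i} → i ∈ e → lookup ω i ∈ s × cls B (lookup ω i) ≡ i
    at {i} i∈e with r ← ∏-bit {b = λ j → agreesᵇ e s j (lookup ω j)} pos i rewrite []=⇒lookup i∈e
      with m , c ← ∧-true {memᵇ (lookup ω i) s} r = lookup⇒[]= _ s m , ⌊⌋-true (_ ≟ᶠ i) c
    to : s ⊆ image (lookup ω) e
    to {y} y∈s with i∈e ← lookup⇒[]= (cls B y) e (allIn⁻ alls y∈s) with ω∈s , cls≡ ← at i∈e =
      subst (_∈ image (lookup ω) e)
        (proj₁ (inComplete B s es) _ y ([]=⇒lookup ω∈s) ([]=⇒lookup y∈s) cls≡) (∈-image⁺ (lookup ω) i∈e)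
    from : image (lookup ω) e ⊆ s
    from y∈ with i , i∈e , refl ← ∈-image⁻ (lookup ω) e y∈ = proj₁ (at i∈e)

  -- The density on `e` is at most the probability that `e` holds. Pairs of an edge `s` of G[e] and
  -- a choice `ω` selecting it are counted twice: each `s` has at least `R` such choices, and each
  -- choice selects at most one `s`.
  edgesOn-sections : ∀ e → edge H e ≡ true → edgesOn B e ℕ.* sections ℕ.≤ total class (bit ∘ holds e) ℕ.* volume e
  edgesOn-sections e ee = begin
    edgesOn B e ℕ.* sections                          ≡⟨ cong (edgesOn B e ℕ.*_) (sections≡volume*rest e) ⟩
    edgesOn B e ℕ.* (volume e ℕ.* R)                  ≡⟨ rearrange (edgesOn B e) (volume e) R ⟩
    edgesOn B e ℕ.* R ℕ.* volume e                    ≤⟨ ℕ.*-monoˡ-≤ (volume e) main ⟩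
    total class (bit ∘ holds e) ℕ.* volume e          ∎
    where
    open ℕ.≤-Reasoning
    R = ∏ (sizeOut e)
    Ss = subsets (N B)
    rearrange : ∀ a b c → a ℕ.* (b ℕ.* c) ≡ a ℕ.* c ℕ.* b
    rearrange = solve-∀
    many : ∀ s → bit (inᵇ e s) ℕ.* R ℕ.≤ bit (inᵇ e s) ℕ.* total class (agrees e s)
    many s with inᵇ e s in eq
    ... | true  = ℕ.*-monoʳ-≤ 1 (agrees-many e s ee eq)
    ... | false = z≤n
    support : ∀ ω s → 0 ℕ.< bit (inᵇ e s) ℕ.* agrees e s ω → s ≡ image (lookup ω) e × inᵇ e s ≡ true
    support ω s pos with inᵇ e s in eq
    ... | true = agrees⇒image e s ω eq (subst (0 ℕ.<_) (ℕ.*-identityˡ _) pos) , refl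
    agrees≤1 : ∀ ω s → agrees e s ω ℕ.≤ 1
    agrees≤1 ω s = subst (agrees e s ω ℕ.≤_) (∏-one {h}) (∏-mono λ i → bit≤1 (agreesᵇ e s i (lookup ω i)))
    below : ∀ ω s → bit (inᵇ e s) ℕ.* agrees e s ω ℕ.≤ bit (holds e ω)
    below ω s with bit (inᵇ e s) ℕ.* agrees e s ω in eq
    ... | zero  = z≤n
    ... | suc _ with s≡ , ines ← support ω s (subst (0 ℕ.<_) (sym eq) (s≤s z≤n)) =
      subst₂ ℕ._≤_ eq (sym (cong bit (trans (sym (cong (edge (G B)) s≡)) (proj₁ (∧-true ines)))))
        (ℕ.*-mono-≤ (bit≤1 (inᵇ e s)) (agrees≤1 ω s))
    main : edgesOn B e ℕ.* R ℕ.≤ total class (bit ∘ holds e)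
    main = begin
      edgesOn B e ℕ.* R                                               ≡⟨ cong (ℕ._* R) (count≡∑ (inᵇ e) Ss) ⟩
      ∑ Ss (bit ∘ inᵇ e) ℕ.* R                                        ≡⟨ ∑-*ʳ Ss R (bit ∘ inᵇ e) ⟨
      ∑ Ss (λ s → bit (inᵇ e s) ℕ.* R)                                ≤⟨ ∑-mono Ss many ⟩
      ∑ Ss (λ s → bit (inᵇ e s) ℕ.* total class (agrees e s))         ≡⟨ ∑-cong Ss (λ s → total-*ˡ class (bit (inᵇ e s)) (agrees e s)) ⟨
      ∑ Ss (λ s → total class (λ ω → bit (inᵇ e s) ℕ.* agrees e s ω)) ≡⟨ total-∑ class Ss _ ⟨
      total class (λ ω → ∑ Ss λ s → bit (inᵇ e s) ℕ.* agrees e s ω)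
        -- For fixed `ω` only `s = image (lookup ω) e` can contribute, and only when `e` holds at
        -- `ω`.
        ≤⟨ total-mono class (λ ω → ∑-unique {b = holds e ω} (subsets-unique (N B)) (below ω) (λ s → proj₁ ∘ support ω s)) ⟩
      total class (bit ∘ holds e)                                     ∎

  minDensity≤density : ∀ e → edge H e ≡ true → minDensity B ≤ density B e
  minDensity≤density e ee = go (∈-subsets e)
    where
    step : Subset h → ℚ → ℚ
    step f q = if edge H f then density B f ⊓ q else q
    go : ∀ {es} → e L.∈ es → foldr step 1ℚ es ≤ density B e
    go {_ ∷ es} (here refl) rewrite ee = p⊓q≤p (density B e) (foldr step 1ℚ es)
    go {f ∷ es} (there e∈es) with edge H f
    ... | true  = ≤-trans (p⊓q≤q (density B f) (foldr step 1ℚ es)) (go e∈es)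
    ... | false = go e∈es

  -- Failures and successes add up to `sections`, and the proportion of successes is at least the
  -- density. The success count is added to both sides to avoid subtraction.
  failures-rare : ∀ e → edge H e ≡ true → ∀ K c →
    volume e ℕ.* K ℕ.≤ volume e ℕ.* c ℕ.+ edgesOn B e ℕ.* K →
    total class (λ ω → bit (not (holds e ω))) ℕ.* K ℕ.≤ sections ℕ.* c
  failures-rare e ee K c hyp =
    ℕ.*-cancelʳ-≤ _ _ v {{>-nonZero (volume-positive e)}} (ℕ.+-cancelʳ-≤ (t ℕ.* v ℕ.* K) _ _ (begin
      f ℕ.* K ℕ.* v ℕ.+ t ℕ.* v ℕ.* K               ≡⟨ rearrange₁ f t K v ⟩
      (f ℕ.+ t) ℕ.* (v ℕ.* K)                       ≡⟨ cong (ℕ._* (v ℕ.* K)) f+t ⟩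
      sections ℕ.* (v ℕ.* K)                        ≤⟨ ℕ.*-monoʳ-≤ sections hyp ⟩
      sections ℕ.* (v ℕ.* c ℕ.+ edgesOn B e ℕ.* K)  ≡⟨ rearrange₂ sections v c (edgesOn B e) K ⟩
      sections ℕ.* c ℕ.* v ℕ.+ edgesOn B e ℕ.* sections ℕ.* K
        ≤⟨ ℕ.+-monoʳ-≤ (sections ℕ.* c ℕ.* v) (ℕ.*-monoˡ-≤ K (edgesOn-sections e ee)) ⟩
      sections ℕ.* c ℕ.* v ℕ.+ t ℕ.* v ℕ.* K        ∎))
    where
    open ℕ.≤-Reasoning
    v = volume e
    t = total class (bit ∘ holds e)
    f = total class (λ ω → bit (not (holds e ω)))
    complement : ∀ b → bit (not b) ℕ.+ bit b ≡ 1
    complement true  = refl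
    complement false = refl
    f+t : f ℕ.+ t ≡ sections
    f+t = trans (sym (total-+ class (bit ∘ not ∘ holds e) (bit ∘ holds e)))
                (total-cong class λ ω → complement (holds e ω))
    rearrange₁ : ∀ f t K v → f ℕ.* K ℕ.* v ℕ.+ t ℕ.* v ℕ.* K ≡ (f ℕ.+ t) ℕ.* (v ℕ.* K)
    rearrange₁ = solve-∀
    rearrange₂ : ∀ s v c n K → s ℕ.* (v ℕ.* c ℕ.+ n ℕ.* K) ≡ s ℕ.* c ℕ.* v ℕ.+ n ℕ.* s ℕ.* K
    rearrange₂ = solve-∀

-- From the local lemma to the critical density.

density-bound : ∀ {m h} {H : KGraph (suc (suc m)) h} D → Local H D → Degenerate H D →
                (B : BlowUp H) → HFree B →
                1ℚ ≤ (1ℚ - minDensity B) * (constBound (suc (suc m)) * ℕtoℚ D)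
-- The inequality between rationals is decidable, so it suffices to refute its negation. The
-- negation makes every edge fail with probability at most 1/(αD), and the local lemma then yields a
-- transversal.
density-bound {m} {h} {H} D local degen B free = decidable-stable (1ℚ ≤? _) λ ¬p → free (transversal ¬p)
  where
  k = suc (suc m)
  k-1 = suc m
  α = constBound k
  α≥0 : NonNegative α
  α≥0 = pos⇒nonNeg α {{constBound-positive m}}
  transversal : ¬ 1ℚ ≤ (1ℚ - minDensity B) * (α * ℕtoℚ D) → Transversal B
  transversal ¬p =
    let ω , ω∈ , all = avoid-all degen
    in lookup ω , (λ i → proj₂ (∈-filter⁻ (λ x → cls B x ≟ᶠ i) {xs = allFin (N B)} (ω∈ i))) , all
    where
    rare : ∀ e → edge H e ≡ true →
           total (class B) (λ ω → bit (not (holds B e ω))) ℕ.* (k ^ k ℕ.* D) ℕ.≤ sections B ℕ.* k-1 ^ k-1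
    rare e ee = failures-rare B e ee (k ^ k ℕ.* D) (k-1 ^ k-1)
      (clear-denominators α {{α≥0}} {k-1 ^ k-1} {k ^ k} (constBound-* m)
        D (edgesOn B e) (volume B e) {{>-nonZero (volume-positive B e)}}
        (minDensity≤density B e ee) (<⇒≤ (≰⇒> ¬p)))
    open LocalLemma H (class B) (holds B) (holds-local B)
      D (sections-positive B) rare local using (avoid-all)

-- Degree conditions for D = Δ - 1.

degree≤maxDegree : ∀ {k h} (H : KGraph k h) v → degree H v ℕ.≤ maxDegree H
degree≤maxDegree {h = h} H v = go (∈-allFin v)
  where
  go : ∀ {vs} → v L.∈ vs → degree H v ℕ.≤ foldr (λ u m → degree H u ℕ.⊔ m) 0 vs
  go (here refl)          = ℕ.m≤m⊔n _ _
  go {u ∷ _} (there v∈vs) = ℕ.≤-trans (go v∈vs) (ℕ.m≤n⊔m (degree H u) _)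

-- Along a path from outside `W` to inside, the first step that enters `W` uses an edge with
-- vertices on both sides.
boundary-edge : ∀ {k h} (H : KGraph k h) (W : Subset h) {u v} → Star (Adjacent H) u v → u ∉ W → v ∈ W →
                ∃ λ w → ∃ λ f → w ∈ W × edge H f ≡ true × w ∈ f × ¬ f ⊆ W
boundary-edge H W ε u∉W v∈W = ⊥-elim (u∉W v∈W)
boundary-edge H W (_◅_ {j = x} (f , ef , u∈f , x∈f) path) u∉W v∈W with x ∈? W
... | yes x∈W = x , f , x∈W , ef , lookup⇒[]= x f x∈f , λ f⊆W → u∉W (f⊆W (lookup⇒[]= _ f u∈f))
... | no  x∉W = boundary-edge H W path x∉W v∈W

Local-maxDegree-1 : ∀ {k h} (H : KGraph (suc k) h) → Local H (maxDegree H ∸ 1)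
Local-maxDegree-1 H {W} {w} ef w∈f f⊈W =
  ℕ.∸-monoˡ-≤ 1 (ℕ.≤-trans (degreeIn<degree H W ef w∈f f⊈W) (degree≤maxDegree H w))

-- Fix a vertex `u` of degree below Δ. If `u` is in `W`, it serves itself; otherwise connectedness
-- gives a vertex of `W` on an edge leaving `W`, which has lost at least one edge.
Degenerate-maxDegree-1 : ∀ {k h} (H : KGraph (suc k) h) → Connected H → ¬ Regular H (maxDegree H) →
                         Degenerate H (maxDegree H ∸ 1)
Degenerate-maxDegree-1 {h = h} H connected irregular {W} (v , v∈W)
  with u , deg≢Δ ← ¬∀⟶∃¬ h (λ u → degree H u ≡ maxDegree H) (λ u → degree H u ℕ.≟ maxDegree H) irregular
  with u ∈? W
... | yes u∈W = u , u∈W , ℕ.∸-monoˡ-≤ 1 (ℕ.≤-<-trans (degreeIn≤degree H W u) (ℕ.≤∧≢⇒< (degree≤maxDegree H u) deg≢Δ))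
... | no  u∉W with w , f , w∈W , ef , w∈f , f⊈W ← boundary-edge H W (connected u v) u∉W v∈W =
  w , w∈W , Local-maxDegree-1 H ef w∈f f⊈W

theorem4 : ∀ (k : ℕ) → 2 N.≤ k →
    (∀ (Δ₀ : ℕ) → ∃ λ (α : ℚ) → (0ℚ < α) × (α ≤ constBound k) ×
    (∀ (h : ℕ) (H : KGraph k h) → Connected H → IsMaxDisjointDegree H Δ₀ →
    ∀ (B : BlowUp H) → HFree B →
    1ℚ ≤ (1ℚ - minDensity B) * (α * ℕtoℚ (maxDegree H))))
    ×
    (∀ (h : ℕ) → ∃ λ (β : ℚ) → (0ℚ < β) × (β ≤ constBound k) ×
    (∀ (H : KGraph k h) → Connected H → ¬ Regular H (maxDegree H) →
    ∀ (B : BlowUp H) → HFree B →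
    1ℚ ≤ (1ℚ - minDensity B) * (β * ℕtoℚ (maxDegree H ∸ 1))))
theorem4 (suc (suc m)) (s≤s (s≤s z≤n)) =
  -- With D = Δ both degree conditions hold at every vertex, since degrees inside `W` never exceed
  -- Δ. The constant is the largest one allowed.
  (λ Δ₀ → constBound k , positive , ≤-refl , λ h H connected max → density-bound (maxDegree H)
    (λ {W} {w} _ _ _ → low H W w) (λ {W} (v , v∈W) → v , v∈W , low H W v)) ,
  (λ h → constBound k , positive , ≤-refl , λ H connected irregular →
    density-bound (maxDegree H ∸ 1) (Local-maxDegree-1 H) (Degenerate-maxDegree-1 H connected irregular))
  where
  k = suc (suc m)
  positive : 0ℚ < constBound k
  positive = positive⁻¹ (constBound k) {{constBound-positive m}}
  low : ∀ {h} (H : KGraph k h) W w → degreeIn H W w ℕ.≤ maxDegree H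
  low H W w = ℕ.≤-trans (degreeIn≤degree H W w) (degree≤maxDegree H w)
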